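{- For each notion of guarding $\mathfrak{g}$ and $\sigma$-structures $\mathcal{A}, \mathcal{B}$, there is a bijective correspondence between (1) coKleisli morphisms, i.e. $\sigma$-homomorphisms, $\mathbb{G}^{\mathfrak{g}} \mathcal{A} \to \mathcal{B}$, and (2) winning strategies for Duplicator in the $\mathfrak{g}$-guarded simulation game from $\mathcal{A}$ to $\mathcal{B}$. Thus $\mathcal{A} \preceq^{\mathfrak{g}} \mathcal{B}$ iff there is a homomorphism $\mathbb{G}^{\mathfrak{g}} \mathcal{A} \to \mathcal{B}$.
   Context: A notion of guarding $\mathfrak{g}$ is atom, loose, or clique guarding; a subset of a $\sigma$-structure is $\mathfrak{g}$-guarded if contained in the support of a tuple satisfying a $\mathfrak{g}$-guard. $\mathbb{G}^{\mathfrak{g}}\mathcal{A}$ is the $\sigma$-structure whose universe consists of equivalence classes $[p,a]$ of focussed plays $\langle p,a\rangle$, where $p=[U_1,\ldots,U_n]$ is a non-empty list of $\mathfrak{g}$-guarded sets of $\mathcal{A}$ and $a \in U_n = \lambda(p)$; $\langle p,a\rangle \sim \langle q,a'\rangle$ iff $a=a'$, the greatest common prefix $p\sqcap q$ is non-empty, and $a$ lies in the last element of every play on the prefix-order paths from $p \sqcap q$ to $p$ and to $q$. Relations: $R^{\mathbb{G}\mathcal{A}} = \{([p,a_1],\ldots,[p,a_r]) \mid R^{\mathcal{A}}(a_1,\ldots,a_r)\}$. The $\mathfrak{g}$-guarded simulation game from $\mathcal{A}$ to $\mathcal{B}$: set $X_0 = \varnothing$, $\varphi_0 = \varnothing$;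 in round $n+1$ Spoiler picks a $\mathfrak{g}$-guarded set $X_{n+1}$ in $\mathcal{A}$, and Duplicator must respond with a $\mathfrak{g}$-guarded set $Y_{n+1}$ in $\mathcal{B}$ and a partial homomorphism $\varphi_{n+1} : X_{n+1} \to Y_{n+1}$ agreeing with $\varphi_n$ on $X_{n+1}\cap X_n$. Duplicator wins if he can always respond. $\mathcal{A} \preceq^{\mathfrak{g}} \mathcal{B}$ means Duplicator has a winning strategy.
   Formalization: Winning strategies are identified when they choose the same partial homomorphisms, ignoring the guarded sets Y; if different Y counted as different strategies, the bijection would fail (e.g. empty A, loose guarding, where Duplicator may choose Y freely). -}

module Defs where

open import Axiom.ExcludedMiddle using (ExcludedMiddle)
open import Data.Fin.Base using (Fin)
open import Data.List.Base using (List)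
open import Data.List.Relation.Unary.All using (All)
open import Data.List.Relation.Unary.Any using (Any)
open import Data.Nat.Base using (ℕ)
open import Data.Product.Base using (Σ; Σ-syntax; ∃-syntax; _×_; _,_; proj₁; proj₂)
open import Data.Sum.Base as Sum using (_⊎_; inj₁; inj₂)
open import Data.Vec.Functional using (Vector)
open import Function.Base using (_∘_; id)
open import Function.Bundles using (Func)
open import Level using (Level; _⊔_; suc)
open import Relation.Binary.Bundles using (Setoid)
open import Relation.Binary.Structures using (IsEquivalence)
open import Relation.Binary.Definitions using (_Respects_; Reflexive; Symmetric; Transitive)
open import Relation.Binary.PropositionalEquality.Core using (_≡_)
import Relation.Binary.Construct.Closure.Equivalence as EqClosure
import Relation.Binary.Construct.On as On
open import Relation.Nullary.Decidable.Core using (yes; no)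
open import Relation.Nullary.Negation.Core using (¬_; contradiction)
open import Relation.Unary using (Pred; _∈_; _⊆_; _≐_)
open import Relation.Unary.Properties using (≐-refl; ≐-sym; ≐-trans)

record Vocabulary (s : Level) : Set (suc s) where
  field
    Symbol : Set s
    arity  : Symbol → ℕ

open Vocabulary

-- The universe is a setoid, because one structure of interest has a
-- quotient as its universe.
record Structure {s : Level} (σ : Vocabulary s) (ℓ : Level) : Set (s ⊔ suc ℓ) where
  field
    universe : Setoid ℓ ℓ

  open Setoid universe public

  field
    rel      : (R : Symbol σ) → Pred (Vector Carrier (arity σ R)) ℓ
    rel-resp : (R : Symbol σ) {t u : Vector Carrier (arity σ R)} →
               (∀ i → t i ≈ u i) → t ∈ rel R → u ∈ rel R

open Structure using (universe; Carrier; rel; rel-resp)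

record Homomorphism {s ℓ₁ ℓ₂ : Level} {σ : Vocabulary s}
                    (A : Structure σ ℓ₁) (B : Structure σ ℓ₂) : Set (s ⊔ ℓ₁ ⊔ ℓ₂) where
  field
    func : Func (universe A) (universe B)

  open Func func public

  field
    preserves : (R : Symbol σ) {t : Vector (Carrier A) (arity σ R)} →
                t ∈ rel A R → to ∘ t ∈ rel B R

open Homomorphism using (to)

-- Two homomorphisms are equal when they agree as maps.
homomorphisms : {s ℓ₁ ℓ₂ : Level} {σ : Vocabulary s} →
                Structure σ ℓ₁ → Structure σ ℓ₂ → Setoid (s ⊔ ℓ₁ ⊔ ℓ₂) (ℓ₁ ⊔ ℓ₂)
homomorphisms A B = record
  { Carrier       = Homomorphism A B
  ; _≈_           = λ f g → ∀ x → to f x B.≈ to g x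
  ; isEquivalence = record
    { refl  = λ _ → B.refl
    ; sym   = λ f≈g x → B.sym (f≈g x)
    ; trans = λ f≈g g≈h x → B.trans (f≈g x) (g≈h x)
    }
  }
  where module B = Structure B

infixl 6 _↾_

-- A homomorphism A ↾ X → B ↾ Y is precisely a partial homomorphism from
-- A to B with domain X and codomain Y.
_↾_ : {s ℓ : Level} {σ : Vocabulary s} (A : Structure σ ℓ) →
      Pred (Carrier A) ℓ → Structure σ ℓ
A ↾ X = record
  { universe = On.setoid (universe A) (proj₁ {B = X})
  ; rel      = λ R t → proj₁ ∘ t ∈ rel A R
  ; rel-resp = λ R t≈u → rel-resp A R t≈u
  }

record Atom {s : Level} (σ : Vocabulary s) (V : Set) : Set s where
  field
    symbol : Symbol σ
    vars   : Vector V (arity σ symbol)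

_OccursIn_ : {s : Level} {σ : Vocabulary s} {V : Set} → V → Atom σ V → Set
v OccursIn α = ∃[ i ] Atom.vars α i ≡ v

CoOccur : {s : Level} {σ : Vocabulary s} {V : Set} → V → V → Atom σ V → Set
CoOccur v w α = v OccursIn α × w OccursIn α

data Guarding : Set where
  atom loose clique : Guarding

-- Guards in the variables x₁ … xₙ.  The co-occurrence conditions include
-- the case i = j, so every xᵢ does occur in the guard.
data Guard {s : Level} (σ : Vocabulary s) (n : ℕ) : Guarding → Set s where
  atomGuard   : (α : Atom σ (Fin n)) →
                (∀ i → i OccursIn α) →
                Guard σ n atom
  looseGuard  : (αs : List (Atom σ (Fin n))) →
                (∀ i j → Any (CoOccur i j) αs) →
                Guard σ n loose
  -- ∃ z₁ … zₖ. ⋀ αs, where zⱼ is the variable inj₂ j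
  cliqueGuard : (k : ℕ) (αs : List (Atom σ (Fin n ⊎ Fin k))) →
                (∀ i j → Any (CoOccur (inj₁ i) (inj₁ j)) αs) →
                Guard σ n clique

module _ {s ℓ : Level} {σ : Vocabulary s} (A : Structure σ ℓ) where
  open Structure A using (_≈_)

  HoldsAt : {V : Set} → (V → Carrier A) → Atom σ V → Set ℓ
  HoldsAt t α = t ∘ Atom.vars α ∈ rel A (Atom.symbol α)

  data Satisfies {n : ℕ} (t : Vector (Carrier A) n) :
                 {g : Guarding} → Guard σ n g → Set (s ⊔ ℓ) where
    atomHolds   : ∀ {α cover} → HoldsAt t α → Satisfies t (atomGuard α cover)
    looseHolds  : ∀ {αs cover} → All (HoldsAt t) αs → Satisfies t (looseGuard αs cover)
    cliqueHolds : ∀ {k αs cover} (z : Vector (Carrier A) k) →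
                  All (HoldsAt Sum.[ t , z ]) αs → Satisfies t (cliqueGuard k αs cover)

  Support : {n : ℕ} → Vector (Carrier A) n → Pred (Carrier A) ℓ
  Support t a = ∃[ i ] t i ≈ a

  IsGuarded : Guarding → Pred (Carrier A) ℓ → Set (s ⊔ ℓ)
  IsGuarded g X = Σ[ n ∈ ℕ ] Σ[ γ ∈ Guard σ n g ] Σ[ t ∈ Vector (Carrier A) n ]
                  Satisfies t γ × X ⊆ Support t

  record GuardedSet (g : Guarding) : Set (s ⊔ suc ℓ) where
    field
      members   : Pred (Carrier A) ℓ
      resp      : members Respects _≈_
      isGuarded : IsGuarded g members

open GuardedSet using (members; resp)

module _ {s ℓ : Level} {σ : Vocabulary s} (g : Guarding) (A : Structure σ ℓ) where
  infixl 5 _∷ʳ_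
  infix  4 _≋_ _⊑_

  -- Non-empty lists, latest move last.
  data Play : Set (s ⊔ suc ℓ) where
    [_]  : GuardedSet A g → Play
    _∷ʳ_ : Play → GuardedSet A g → Play

  last : Play → GuardedSet A g
  last [ X ]    = X
  last (_ ∷ʳ X) = X

  -- Guarded sets are compared extensionally, and so are plays.
  data _≋_ : Play → Play → Set (s ⊔ suc ℓ) where
    [_]  : ∀ {X Y} → members X ≐ members Y → [ X ] ≋ [ Y ]
    _∷ʳ_ : ∀ {p q X Y} → p ≋ q → members X ≐ members Y → p ∷ʳ X ≋ q ∷ʳ Y

  data _⊑_ (p : Play) : Play → Set (s ⊔ suc ℓ) where
    equal : ∀ {q} → p ≋ q → p ⊑ q
    later : ∀ {q X} → p ⊑ q → p ⊑ q ∷ʳ X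

  -- As plays are non-empty, such an r exists precisely when the greatest
  -- common prefix of the lists p and q is non-empty.
  record IsGreatestCommonPrefix (r p q : Play) : Set (s ⊔ suc ℓ) where
    field
      prefixˡ  : r ⊑ p
      prefixʳ  : r ⊑ q
      greatest : ∀ {u} → u ⊑ p → u ⊑ q → u ⊑ r

  OnPath : Carrier A → Play → Play → Set (s ⊔ suc ℓ)
  OnPath a r p = ∀ u → r ⊑ u → u ⊑ p → a ∈ members (last u)

  record FocussedPlay : Set (s ⊔ suc ℓ) where
    constructor ⟨_,_⟩
    field
      play  : Play
      focus : Σ (Carrier A) (members (last play))

    point : Carrier A
    point = proj₁ focus

  open FocussedPlay

  infix 4 _∼_

  record _∼_ (x y : FocussedPlay) : Set (s ⊔ suc ℓ) where
    field
      samePoint : Structure._≈_ A (point x) (point y)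
      meet      : Play
      isMeet    : IsGreatestCommonPrefix meet (play x) (play y)
      pathˡ     : OnPath (point x) meet (play x)
      pathʳ     : OnPath (point x) meet (play y)

  -- Showing that _∼_ is transitive takes excluded middle, as equality of
  -- guarded sets need not be decidable.  Passing to the generated
  -- equivalence avoids assuming it, and classically changes nothing:
  -- see ∼-isEquivalence and closure⇒∼ below.
  𝔾-universe : Setoid (s ⊔ suc ℓ) (s ⊔ suc ℓ)
  𝔾-universe = EqClosure.setoid _∼_

  𝔾 : Structure σ (s ⊔ suc ℓ)
  𝔾 = record
    { universe = 𝔾-universe
    ; rel      = λ R xs →
        Σ[ p ∈ Play ] Σ[ as ∈ Vector (Σ (Carrier A) (members (last p))) (arity σ R) ]
        proj₁ ∘ as ∈ rel A R × (∀ i → xs i 𝔾.≈ ⟨ p , as i ⟩)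
    ; rel-resp = λ _ xs≈ys (p , as , Ras , xs≈) →
        p , as , Ras , λ i → 𝔾.trans (𝔾.sym (xs≈ys i)) (xs≈ i)
    }
    where module 𝔾 = Setoid 𝔾-universe

  private
    module A = Structure A

    ≋-refl : ∀ {p} → p ≋ p
    ≋-refl {[ _ ]}  = [ ≐-refl ]
    ≋-refl {_ ∷ʳ _} = ≋-refl ∷ʳ ≐-refl

    ≋-sym : ∀ {p q} → p ≋ q → q ≋ p
    ≋-sym [ X≐Y ]       = [ ≐-sym X≐Y ]
    ≋-sym (p≋q ∷ʳ X≐Y) = ≋-sym p≋q ∷ʳ ≐-sym X≐Y

    ≋-trans : ∀ {p q r} → p ≋ q → q ≋ r → p ≋ r
    ≋-trans [ X≐Y ]       [ Y≐Z ]       = [ ≐-trans X≐Y Y≐Z ]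
    ≋-trans (p≋q ∷ʳ X≐Y) (q≋r ∷ʳ Y≐Z) = ≋-trans p≋q q≋r ∷ʳ ≐-trans X≐Y Y≐Z

    ⊑-respʳ : ∀ {p q r} → p ⊑ q → q ≋ r → p ⊑ r
    ⊑-respʳ (equal p≋q) q≋r       = equal (≋-trans p≋q q≋r)
    ⊑-respʳ (later p⊑q) (q≋r ∷ʳ _) = later (⊑-respʳ p⊑q q≋r)

    ⊑-trans : ∀ {p q r} → p ⊑ q → q ⊑ r → p ⊑ r
    ⊑-trans p⊑q (equal q≋r) = ⊑-respʳ p⊑q q≋r
    ⊑-trans p⊑q (later q⊑r) = later (⊑-trans p⊑q q⊑r)

    ⊑-comparable : ∀ {p q r} → p ⊑ r → q ⊑ r → p ⊑ q ⊎ q ⊑ p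
    ⊑-comparable (equal p≋r) q⊑r         = inj₂ (⊑-respʳ q⊑r (≋-sym p≋r))
    ⊑-comparable (later p⊑r) (equal q≋r) = inj₁ (⊑-respʳ (later p⊑r) (≋-sym q≋r))
    ⊑-comparable (later p⊑r) (later q⊑r) = ⊑-comparable p⊑r q⊑r

    ⊑-init : ∀ {p q X} → p ∷ʳ X ⊑ q → p ⊑ q
    ⊑-init (equal (p≋q ∷ʳ _)) = later (equal p≋q)
    ⊑-init (later pX⊑q)       = later (⊑-init pX⊑q)

    ∷ʳ⋢ : ∀ {p X} → ¬ (p ∷ʳ X ⊑ p)
    ∷ʳ⋢ (equal (pX≋p ∷ʳ _)) = ∷ʳ⋢ (equal pX≋p)
    ∷ʳ⋢ (later pX⊑p)        = ∷ʳ⋢ (⊑-init pX⊑p)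

    ⊑-antisym : ∀ {p q} → p ⊑ q → q ⊑ p → p ≋ q
    ⊑-antisym (equal p≋q) _    = p≋q
    ⊑-antisym (later p⊑q) qX⊑p = contradiction (⊑-trans qX⊑p p⊑q) ∷ʳ⋢

    last-cong : ∀ {p q} → p ≋ q → members (last p) ≐ members (last q)
    last-cong [ X≐Y ]     = X≐Y
    last-cong (_ ∷ʳ X≐Y) = X≐Y

    ∼-refl : Reflexive _∼_
    ∼-refl {⟨ p , (a , a∈) ⟩} = record
      { samePoint = A.refl
      ; meet      = p
      ; isMeet    = record { prefixˡ = equal ≋-refl ; prefixʳ = equal ≋-refl ; greatest = λ u⊑p _ → u⊑p }
      ; pathˡ     = path
      ; pathʳ     = path
      }
      where
      path : OnPath a p p
      path u p⊑u u⊑p = proj₁ (last-cong (⊑-antisym p⊑u u⊑p)) a∈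

    ∼-sym : Symmetric _∼_
    ∼-sym x∼y = record
      { samePoint = A.sym samePoint
      ; meet      = meet
      ; isMeet    = record { prefixˡ = prefixʳ ; prefixʳ = prefixˡ ; greatest = λ u⊑q u⊑p → greatest u⊑p u⊑q }
      ; pathˡ     = λ u r⊑u u⊑q → resp (last u) samePoint (pathʳ u r⊑u u⊑q)
      ; pathʳ     = λ u r⊑u u⊑p → resp (last u) samePoint (pathˡ u r⊑u u⊑p)
      }
      where
      open _∼_ x∼y
      open IsGreatestCommonPrefix isMeet

    module _ (em : ExcludedMiddle (s ⊔ suc ℓ)) where
      meet-exists : ∀ p q {r} → r ⊑ p → r ⊑ q → ∃[ m ] IsGreatestCommonPrefix m p q
      meet-exists p q r⊑p r⊑q with em {p ⊑ q}
      meet-exists p q r⊑p r⊑q | yes p⊑q = p , record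
        { prefixˡ = equal ≋-refl ; prefixʳ = p⊑q ; greatest = λ u⊑p _ → u⊑p }
      meet-exists p q (equal r≋p) r⊑q | no p⋢q =
        contradiction (⊑-trans (equal (≋-sym r≋p)) r⊑q) p⋢q
      meet-exists (p ∷ʳ X) q (later r⊑p) r⊑q | no pX⋢q with meet-exists p q r⊑p r⊑q
      ... | m , isMeet = m , record
        { prefixˡ  = later prefixˡ
        ; prefixʳ  = prefixʳ
        ; greatest = λ
          { (equal u≋pX) u⊑q → contradiction (⊑-trans (equal (≋-sym u≋pX)) u⊑q) pX⋢q
          ; (later u⊑p)  u⊑q → greatest u⊑p u⊑q
          }
        }
        where open IsGreatestCommonPrefix isMeet

      -- If some common prefix witnesses x ∼ y, then so does the greatest.
      fromCommonPrefix : ∀ {x y r} → point x A.≈ point y →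
                         r ⊑ play x → r ⊑ play y →
                         OnPath (point x) r (play x) → OnPath (point x) r (play y) → x ∼ y
      fromCommonPrefix x≈y r⊑p r⊑q pathˡ pathʳ with meet-exists _ _ r⊑p r⊑q
      ... | m , isMeet = record
        { samePoint = x≈y
        ; meet      = m
        ; isMeet    = isMeet
        ; pathˡ     = λ u m⊑u → pathˡ u (⊑-trans (greatest r⊑p r⊑q) m⊑u)
        ; pathʳ     = λ u m⊑u → pathʳ u (⊑-trans (greatest r⊑p r⊑q) m⊑u)
        }
        where open IsGreatestCommonPrefix isMeet

      glue : ∀ {x y z} (x∼y : x ∼ y) (y∼z : y ∼ z) → _∼_.meet x∼y ⊑ _∼_.meet y∼z → x ∼ z
      glue x∼y y∼z r⊑m = fromCommonPrefix
        (A.trans L.samePoint R.samePoint)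
        LM.prefixˡ
        (⊑-trans r⊑m RM.prefixʳ)
        L.pathˡ
        λ u r⊑u u⊑z → Sum.[ (λ u⊑m → L.pathʳ u r⊑u (⊑-trans u⊑m RM.prefixˡ))
                          , (λ m⊑u → resp (last u) (A.sym L.samePoint) (R.pathʳ u m⊑u u⊑z))
                          ] (⊑-comparable u⊑z RM.prefixʳ)
        where
        module L = _∼_ x∼y
        module R = _∼_ y∼z
        module LM = IsGreatestCommonPrefix L.isMeet
        module RM = IsGreatestCommonPrefix R.isMeet

      ∼-trans : Transitive _∼_
      ∼-trans x∼y y∼z with ⊑-comparable (IsGreatestCommonPrefix.prefixʳ (_∼_.isMeet x∼y))
                                        (IsGreatestCommonPrefix.prefixˡ (_∼_.isMeet y∼z))
      ... | inj₁ r⊑m = glue x∼y y∼z r⊑m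
      ... | inj₂ m⊑r = ∼-sym (glue (∼-sym y∼z) (∼-sym x∼y) m⊑r)

  ∼-isEquivalence : ExcludedMiddle (s ⊔ suc ℓ) → IsEquivalence _∼_
  ∼-isEquivalence em = record { refl = ∼-refl ; sym = ∼-sym ; trans = ∼-trans em }

  closure⇒∼ : ExcludedMiddle (s ⊔ suc ℓ) → ∀ {x y} → Setoid._≈_ 𝔾-universe x y → x ∼ y
  closure⇒∼ em = EqClosure.fold (∼-isEquivalence em) id

module _ {s ℓ : Level} {σ : Vocabulary s} (g : Guarding) (A B : Structure σ ℓ) where
  private
    module B = Structure B

  -- Duplicator's own moves are determined by his strategy and Spoiler's
  -- moves so far, so a strategy assigns to each play p of Spoiler
  -- Duplicator's response to the last move of p.  It wins when all these
  -- responses are legal.  In the first round agreement with φ₀ = ∅ is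
  -- vacuous.
  record WinningStrategy : Set (s ⊔ suc ℓ) where
    field
      Y : Play g A → GuardedSet B g
      φ : (p : Play g A) → Homomorphism (A ↾ members (last g A p)) (B ↾ members (Y p))

    value : (p : Play g A) {a : Carrier A} → a ∈ members (last g A p) → Carrier B
    value p {a} a∈ = proj₁ (to (φ p) (a , a∈))

    field
      agrees : ∀ p X {a} (a∈p : a ∈ members (last g A p)) (a∈X : a ∈ members X) →
               value (p ∷ʳ X) a∈X B.≈ value p a∈p

      -- Lists of equal sets are the same play, so get the same response.
      Y-cong : ∀ {p q} → _≋_ g A p q → members (Y p) ≐ members (Y q)
      φ-cong : ∀ {p q} → _≋_ g A p q →
               ∀ {a} (a∈p : a ∈ members (last g A p)) (a∈q : a ∈ members (last g A q)) →
               value p a∈p B.≈ value q a∈q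

  open WinningStrategy

  -- Strategies are identified when they choose the same partial
  -- homomorphisms.  The sets Y p are ignored: Y p may be any guarded set
  -- containing the image of φ p, so they are not determined by the φ p.
  winningStrategies : Setoid (s ⊔ suc ℓ) (s ⊔ suc ℓ)
  winningStrategies = record
    { Carrier       = WinningStrategy
    ; _≈_           = λ S T → ∀ p {a} (a∈p : a ∈ members (last g A p)) →
                      value S p a∈p B.≈ value T p a∈p
    ; isEquivalence = record
      { refl  = λ _ _ → B.refl
      ; sym   = λ S≈T p a∈p → B.sym (S≈T p a∈p)
      ; trans = λ S≈T T≈U p a∈p → B.trans (S≈T p a∈p) (T≈U p a∈p)
      }
    }

infix 4 _≼[_]_

_≼[_]_ : {s ℓ : Level} {σ : Vocabulary s} →
         Structure σ ℓ → Guarding → Structure σ ℓ → Set (s ⊔ suc ℓ)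
A ≼[ g ] B = WinningStrategy g A B

{-# OPTIONS --safe #-}

-- A strategy S and a homomorphism h correspond via h [p,a] = φ_p(a): agreement
-- of consecutive φ's along paths is exactly invariance under ∼.  The one point
-- needing work is that the image of h on the last set of p is guarded.  If
-- that set lies in the support of t, where t satisfies a guard γ, then h maps
-- the play p, Support t to a tuple satisfying γ, provided all variables of γ
-- are among those of t.  In a clique guard the bound variables need not be:
-- each atom is then mapped along its own further extension of the play.
-- A bound variable may get different values for different atoms, so the guard
-- used in B has the bound variables of distinct atoms renamed apart.
module Submission where

open import Defs
open import Level using (Level)
open import Data.Product.Base using (_×_)
open import Function.Bundles using (Bijection; _⇔_)

open import Data.Fin.Base using (Fin; _↑ˡ_; _↑ʳ_)
open import Data.List.Base using (List; []; _∷_; map)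
open import Data.List.Relation.Unary.All as All using (All; []; _∷_)
import Data.List.Relation.Unary.All.Properties as All
open import Data.List.Relation.Unary.Any as Any using (Any; here; there)
import Data.List.Relation.Unary.Any.Properties as Any
open import Data.Nat.Base using (ℕ; _+_)
open import Data.Product.Base using (Σ; Σ-syntax; _,_; proj₁; proj₂)
open import Data.Sum.Base as Sum using (_⊎_; inj₁; inj₂)
open import Data.Vec.Functional as Vector using (Vector)
open import Data.Vec.Functional.Properties using (lookup-++ˡ; lookup-++ʳ)
open import Function.Base using (_∘_; id)
open import Function.Bundles using (mk⇔)
open import Relation.Binary.PropositionalEquality.Core using (_≡_; refl; sym; cong)
open import Relation.Nullary.Negation.Core using (¬_; contradiction)
open import Relation.Unary using (Pred; _∈_; _⊆_; _≐_)
open import Relation.Unary.Properties using (≐-refl; ≐-sym; ≐-trans)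
import Relation.Binary.Construct.Closure.Equivalence as EqClosure

open Vocabulary using (arity)
open Structure using (Carrier; rel; rel-resp)
open GuardedSet using (members; resp; isGuarded)

private variable
  s ℓ : Level

-- Prefix order on plays and basic instances of `∼`.

module Plays {s ℓ : Level} {σ : Vocabulary s} (g : Guarding) (A : Structure σ ℓ) where
  private module A = Structure A

  infix 4 _≋ᴾ_ _⊑ᴾ_

  _≋ᴾ_ _⊑ᴾ_ : Play g A → Play g A → Set (s Level.⊔ Level.suc ℓ)
  _≋ᴾ_ = _≋_ g A
  _⊑ᴾ_ = _⊑_ g A

  lastSet : Play g A → Pred (Carrier A) ℓ
  lastSet p = members (last g A p)

  ≋-refl : ∀ {p} → p ≋ᴾ p
  ≋-refl {[ _ ]}  = [ ≐-refl ]
  ≋-refl {_ ∷ʳ _} = ≋-refl ∷ʳ ≐-refl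

  ≋-sym : ∀ {p q} → p ≋ᴾ q → q ≋ᴾ p
  ≋-sym [ X≐Y ]      = [ ≐-sym X≐Y ]
  ≋-sym (p≋q ∷ʳ X≐Y) = ≋-sym p≋q ∷ʳ ≐-sym X≐Y

  ≋-trans : ∀ {p q r} → p ≋ᴾ q → q ≋ᴾ r → p ≋ᴾ r
  ≋-trans [ X≐Y ]      [ Y≐Z ]      = [ ≐-trans X≐Y Y≐Z ]
  ≋-trans (p≋q ∷ʳ X≐Y) (q≋r ∷ʳ Y≐Z) = ≋-trans p≋q q≋r ∷ʳ ≐-trans X≐Y Y≐Z

  last-cong : ∀ {p q} → p ≋ᴾ q → lastSet p ≐ lastSet q
  last-cong [ X≐Y ]    = X≐Y
  last-cong (_ ∷ʳ X≐Y) = X≐Y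

  ⊑-refl : ∀ {p} → p ⊑ᴾ p
  ⊑-refl = equal ≋-refl

  ⊑-respʳ : ∀ {p q r} → p ⊑ᴾ q → q ≋ᴾ r → p ⊑ᴾ r
  ⊑-respʳ (equal p≋q) q≋r        = equal (≋-trans p≋q q≋r)
  ⊑-respʳ (later p⊑q) (q≋r ∷ʳ _) = later (⊑-respʳ p⊑q q≋r)

  ⊑-trans : ∀ {p q r} → p ⊑ᴾ q → q ⊑ᴾ r → p ⊑ᴾ r
  ⊑-trans p⊑q (equal q≋r) = ⊑-respʳ p⊑q q≋r
  ⊑-trans p⊑q (later q⊑r) = later (⊑-trans p⊑q q⊑r)

  ⊑-init : ∀ {p q X} → p ∷ʳ X ⊑ᴾ q → p ⊑ᴾ q
  ⊑-init (equal (p≋q ∷ʳ _)) = later (equal p≋q)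
  ⊑-init (later pX⊑q)       = later (⊑-init pX⊑q)

  ∷ʳ⋢ : ∀ {p X} → ¬ (p ∷ʳ X ⊑ᴾ p)
  ∷ʳ⋢ (equal (pX≋p ∷ʳ _)) = ∷ʳ⋢ (equal pX≋p)
  ∷ʳ⋢ (later pX⊑p)        = ∷ʳ⋢ (⊑-init pX⊑p)

  ⊑-antisym : ∀ {p q} → p ⊑ᴾ q → q ⊑ᴾ p → p ≋ᴾ q
  ⊑-antisym (equal p≋q) _    = p≋q
  ⊑-antisym (later p⊑q) qX⊑p = contradiction (⊑-trans qX⊑p p⊑q) ∷ʳ⋢

  -- By antisymmetry, every play between `p` and `q` is `≋` to both.
  OnPath-≋ : ∀ {a p q} → p ≋ᴾ q → a ∈ lastSet q → OnPath g A a p q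
  OnPath-≋ p≋q a∈q u p⊑u u⊑q =
    proj₁ (last-cong (⊑-antisym (⊑-trans (equal (≋-sym p≋q)) p⊑u) u⊑q)) a∈q

  OnPath-∷ʳ : ∀ {a p X} → a ∈ lastSet p → a ∈ members X → OnPath g A a p (p ∷ʳ X)
  OnPath-∷ʳ a∈p a∈X u p⊑u (equal u≋pX) = proj₂ (last-cong u≋pX) a∈X
  OnPath-∷ʳ a∈p a∈X u p⊑u (later u⊑p)  = OnPath-≋ ≋-refl a∈p u p⊑u u⊑p

  ≋⇒∼ : ∀ {p q a b} {a∈p : a ∈ lastSet p} {b∈q : b ∈ lastSet q} →
        p ≋ᴾ q → a A.≈ b → _∼_ g A ⟨ p , (a , a∈p) ⟩ ⟨ q , (b , b∈q) ⟩
  ≋⇒∼ {p} {q} {a∈p = a∈p} {b∈q} p≋q a≈b = record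
    { samePoint = a≈b
    ; meet      = p
    ; isMeet    = record { prefixˡ = ⊑-refl ; prefixʳ = equal p≋q ; greatest = λ u⊑p _ → u⊑p }
    ; pathˡ     = OnPath-≋ ≋-refl a∈p
    ; pathʳ     = OnPath-≋ p≋q (resp (last g A q) (A.sym a≈b) b∈q)
    }

  -- The shorter play is itself the meet, and only the two plays lie on the path. This instance
  -- turns invariance under `∼` into agreement in consecutive rounds.
  ∷ʳ∼ : ∀ {p X a b} {a∈X : a ∈ members X} {b∈p : b ∈ lastSet p} →
        a A.≈ b → _∼_ g A ⟨ p ∷ʳ X , (a , a∈X) ⟩ ⟨ p , (b , b∈p) ⟩
  ∷ʳ∼ {p} {a∈X = a∈X} {b∈p} a≈b = record
    { samePoint = a≈b
    ; meet      = p
    ; isMeet    = record { prefixˡ = later ⊑-refl ; prefixʳ = ⊑-refl ; greatest = λ _ u⊑p → u⊑p }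
    ; pathˡ     = OnPath-∷ʳ a∈p a∈X
    ; pathʳ     = OnPath-≋ ≋-refl a∈p
    }
    where a∈p = resp (last g A p) (A.sym a≈b) b∈p

-- Separating the bound variables of clique guards.

module _ {σ : Vocabulary s} where

  relabel : {V W : Set} → (V → W) → Atom σ V → Atom σ W
  relabel f α = record { symbol = Atom.symbol α ; vars = f ∘ Atom.vars α }

  OccursIn-relabel : {V W : Set} (f : V → W) (α : Atom σ V) {v : V} →
                     v OccursIn α → f v OccursIn relabel f α
  OccursIn-relabel f α (i , eq) = i , cong f eq

  -- Every occurrence of a bound variable becomes a variable of its own, named by its argument
  -- position. The argument tuple in `B` can then serve directly as the valuation of the bound
  -- variables.
  boundToPositions : {n k : ℕ} (α : Atom σ (Fin n ⊎ Fin k)) →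
                     Atom σ (Fin n ⊎ Fin (arity σ (Atom.symbol α)))
  boundToPositions α = record
    { symbol = Atom.symbol α
    ; vars   = λ i → Sum.map₂ (λ _ → i) (Atom.vars α i)
    }

  OccursIn-boundToPositions : {n k : ℕ} (α : Atom σ (Fin n ⊎ Fin k)) {x : Fin n} →
                              inj₁ x OccursIn α → inj₁ x OccursIn boundToPositions α
  OccursIn-boundToPositions α (i , eq) = i , cong (Sum.map₂ (λ _ → i)) eq

module _ {σ : Vocabulary s} (B : Structure σ ℓ) where
  private module B = Structure B

  HoldsAt-relabel : {V W : Set} (f : V → W) {v : V → Carrier B} (w : W → Carrier B) →
                    (∀ x → v x B.≈ w (f x)) → (α : Atom σ V) →
                    HoldsAt B v α → HoldsAt B w (relabel f α)
  HoldsAt-relabel f w v≈wf α = rel-resp B (Atom.symbol α) (v≈wf ∘ Atom.vars α)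

  -- `w` is the full argument tuple of the atom. Only its free positions are tied to `t`, so other
  -- atoms may read the same bound variable differently.
  HoldsSeparately : {n k : ℕ} → Vector (Carrier B) n → Atom σ (Fin n ⊎ Fin k) → Set ℓ
  HoldsSeparately t α =
    Σ[ w ∈ Vector (Carrier B) (arity σ (Atom.symbol α)) ]
    w ∈ rel B (Atom.symbol α) × (∀ i x → Atom.vars α i ≡ inj₁ x → w i B.≈ t x)

  HoldsAt-boundToPositions : {n k : ℕ} {t : Vector (Carrier B) n} (α : Atom σ (Fin n ⊎ Fin k)) →
                             ((w , _) : HoldsSeparately t α) →
                             HoldsAt B Sum.[ t , w ] (boundToPositions α)
  HoldsAt-boundToPositions {t = t} α (w , Rw , w≈t) = rel-resp B (Atom.symbol α) w≈ Rw
    where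
    w≈ : ∀ i → w i B.≈ Sum.[ t , w ] (Sum.map₂ (λ _ → i) (Atom.vars α i))
    -- At a bound position the new variable is `i` itself, whose value is `w i` by definition.
    w≈ i with Atom.vars α i in eq
    ... | inj₁ x = w≈t i x eq
    ... | inj₂ _ = B.refl

  record RenamedApart {n k : ℕ} (t : Vector (Carrier B) n)
                      (αs : List (Atom σ (Fin n ⊎ Fin k))) : Set (s Level.⊔ ℓ) where
    field
      {width}  : ℕ
      atoms    : List (Atom σ (Fin n ⊎ Fin width))
      values   : Vector (Carrier B) width
      holds    : All (HoldsAt B Sum.[ t , values ]) atoms
      coOccurs : ∀ x y → Any (CoOccur (inj₁ x) (inj₁ y)) αs → Any (CoOccur (inj₁ x) (inj₁ y)) atoms

  -- Each atom receives a block of bound variables as long as its arity, and the blocks are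
  -- concatenated. Free variables stay fixed, so their co-occurrences survive.
  renameApart : {n k : ℕ} {t : Vector (Carrier B) n} {αs : List (Atom σ (Fin n ⊎ Fin k))} →
                All (HoldsSeparately t) αs → RenamedApart t αs
  renameApart [] = record { width = 0 ; atoms = [] ; values = λ () ; holds = [] ; coOccurs = λ _ _ () }
  renameApart {n} {t = t} {αs = α ∷ αs} (Hα ∷ Hαs) = record
    { atoms    = relabel left (boundToPositions α) ∷ map (relabel right) atoms
    ; values   = w Vector.++ values
    ; holds    = HoldsAt-relabel left Sum.[ t , w Vector.++ values ] left≈ (boundToPositions α) (HoldsAt-boundToPositions α Hα)
               ∷ All.map⁺ (All.map (λ {β} → HoldsAt-relabel right Sum.[ t , w Vector.++ values ] right≈ β) holds)
    ; coOccurs = coOccurs′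
    }
    where
    open RenamedApart (renameApart Hαs)

    r : ℕ
    r = arity σ (Atom.symbol α)

    w : Vector (Carrier B) r
    w = proj₁ Hα

    left : Fin n ⊎ Fin r → Fin n ⊎ Fin (r + width)
    left = Sum.map₂ (_↑ˡ width)

    right : Fin n ⊎ Fin width → Fin n ⊎ Fin (r + width)
    right = Sum.map₂ (r ↑ʳ_)

    left≈ : ∀ v → Sum.[ t , w ] v B.≈ Sum.[ t , w Vector.++ values ] (left v)
    left≈ (inj₁ _) = B.refl
    left≈ (inj₂ i) = B.reflexive (sym (lookup-++ˡ w values i))

    right≈ : ∀ v → Sum.[ t , values ] v B.≈ Sum.[ t , w Vector.++ values ] (right v)
    right≈ (inj₁ _) = B.refl
    right≈ (inj₂ i) = B.reflexive (sym (lookup-++ʳ w values i))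

    coOccurs′ : ∀ x y → Any (CoOccur (inj₁ x) (inj₁ y)) (α ∷ αs) →
                Any (CoOccur (inj₁ x) (inj₁ y)) (relabel left (boundToPositions α) ∷ map (relabel right) atoms)
    coOccurs′ x y (here (x∈α , y∈α)) =
      here ( OccursIn-relabel left (boundToPositions α) (OccursIn-boundToPositions α x∈α)
           , OccursIn-relabel left (boundToPositions α) (OccursIn-boundToPositions α y∈α))
    coOccurs′ x y (there xy∈αs) = there (Any.map⁺ (Any.map
      (λ {β} (x∈β , y∈β) → OccursIn-relabel right β x∈β , OccursIn-relabel right β y∈β)
      (coOccurs x y xy∈αs)))

-- Guarded sets given by tuples, and the values of a homomorphism on plays.

module _ {σ : Vocabulary s} (A : Structure σ ℓ) where
  private module A = Structure A

  supportSet : ∀ {g n} (γ : Guard σ n g) (t : Vector (Carrier A) n) → Satisfies A t γ → GuardedSet A g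
  supportSet γ t ⊨γ = record
    { members   = Support A t
    ; resp      = λ a≈b (i , ti≈a) → i , A.trans ti≈a a≈b
    ; isGuarded = _ , γ , t , ⊨γ , id
    }

  -- A related tuple is guarded by the single atom over distinct variables, in which any two of them
  -- co-occur.
  related⇒cliqueGuarded : ∀ R {t} → t ∈ rel A R → GuardedSet A clique
  related⇒cliqueGuarded R {t} Rt = supportSet
    (cliqueGuard 0 (record { symbol = R ; vars = inj₁ } ∷ []) λ i j → here ((i , refl) , (j , refl)))
    t (cliqueHolds (λ ()) (Rt ∷ []))

module _ {σ : Vocabulary s} (g : Guarding) (A B : Structure σ ℓ) where
  open Plays g A
  private
    module A = Structure A
    module B = Structure B

  module FromHomomorphism (h : Homomorphism (𝔾 g A) B) where
    module h = Homomorphism h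

    at : (p : Play g A) {a : Carrier A} → a ∈ lastSet p → Carrier B
    at p a∈p = h.to ⟨ p , (_ , a∈p) ⟩

    at-∷ʳ : ∀ {p X a b} {a∈X : a ∈ members X} {b∈p : b ∈ lastSet p} →
            a A.≈ b → at (p ∷ʳ X) a∈X B.≈ at p b∈p
    at-∷ʳ a≈b = h.cong (EqClosure.return (∷ʳ∼ a≈b))

    at-cong : ∀ {p q a b} {a∈p : a ∈ lastSet p} {b∈q : b ∈ lastSet q} →
              p ≋ᴾ q → a A.≈ b → at p a∈p B.≈ at q b∈q
    at-cong p≋q a≈b = h.cong (EqClosure.return (≋⇒∼ p≋q a≈b))

    at-preserves : ∀ p R (t : Vector (Σ (Carrier A) (lastSet p)) (arity σ R)) →
                   proj₁ ∘ t ∈ rel A R → (λ i → at p (proj₂ (t i))) ∈ rel B R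
    at-preserves p R t Rt = h.preserves R (p , t , Rt , λ _ → Structure.refl (𝔾 g A))

    Image : Play g A → Pred (Carrier B) ℓ
    Image p b = Σ[ a ∈ Carrier A ] Σ[ a∈p ∈ lastSet p a ] at p a∈p B.≈ b

    Image-cong : ∀ {p q} → p ≋ᴾ q → Image p ⊆ Image q
    Image-cong p≋q (a , a∈p , pa≈b) =
      a , proj₁ (last-cong p≋q) a∈p , B.trans (B.sym (at-cong p≋q A.refl)) pa≈b

-- Images of guarded tuples are guarded.

module _ {σ : Vocabulary s} (A B : Structure σ ℓ) where

  -- Entries of `t` may lie outside the last set of `p`; playing the whole support gives each of
  -- them a value.
  supportImage : (g : Guarding) (h : Homomorphism (𝔾 g A) B) (p : Play g A)
                 {n : ℕ} (γ : Guard σ n g) (t : Vector (Carrier A) n) (⊨γ : Satisfies A t γ) →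
                 Vector (Carrier B) n
  supportImage g h p γ t ⊨γ i =
    FromHomomorphism.at g A B h (p ∷ʳ supportSet A γ t ⊨γ) {t i} (i , Structure.refl A)

  supportImage-isGuard :
    (g : Guarding) (h : Homomorphism (𝔾 g A) B) (p : Play g A)
    {n : ℕ} (γ : Guard σ n g) (t : Vector (Carrier A) n) (⊨γ : Satisfies A t γ) →
    Σ[ δ ∈ Guard σ n g ] Satisfies B (supportImage g h p γ t ⊨γ) δ
  supportImage-isGuard .atom h p γ@(atomGuard α cover) t ⊨γ@(atomHolds Rt) =
    γ , atomHolds (at-preserves _ (Atom.symbol α) (λ i → _ , (Atom.vars α i , Structure.refl A)) Rt)
    where open FromHomomorphism atom A B h
  supportImage-isGuard .loose h p γ@(looseGuard αs cover) t ⊨γ@(looseHolds Rts) =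
    γ , looseHolds (All.map
      (λ {α} → at-preserves _ (Atom.symbol α) (λ i → _ , (Atom.vars α i , Structure.refl A))) Rts)
    where open FromHomomorphism loose A B h
  supportImage-isGuard .clique h p {n} γ@(cliqueGuard k αs cover) t ⊨γ@(cliqueHolds z Rtzs) =
    cliqueGuard width atoms (λ i j → coOccurs i j (cover i j)) , cliqueHolds values holds
    where
    open FromHomomorphism clique A B h

    p′ : Play clique A
    p′ = p ∷ʳ supportSet A γ t ⊨γ

    separately : ∀ {α} → HoldsAt A Sum.[ t , z ] α → HoldsSeparately B (supportImage clique h p γ t ⊨γ) α
    separately {α} Rtz =
        (λ i → at p″ (i , Structure.refl A))
      , at-preserves p″ (Atom.symbol α) (λ i → _ , (i , Structure.refl A)) Rtz
      -- At a free position the entry of the atom's tuple is `t x`, which lies in the last sets of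
      -- both `p″` and `p′`, so its value is unchanged.
      , λ i x eq → at-∷ʳ (Structure.reflexive A (cong Sum.[ t , z ] eq))
      where
      p″ : Play clique A
      p″ = p′ ∷ʳ related⇒cliqueGuarded A (Atom.symbol α) Rtz

    open RenamedApart (renameApart B (All.map (λ {α} → separately {α}) Rtzs))

-- Passing between homomorphisms and strategies.

module _ {σ : Vocabulary s} (g : Guarding) (A B : Structure σ ℓ) where
  open Plays g A
  private
    module A = Structure A
    module B = Structure B

  toStrategy : Homomorphism (𝔾 g A) B → WinningStrategy g A B
  toStrategy h = record
    -- The image is the least possible response; equality of strategies sees only the maps.
    { Y = λ p → record
      { members   = Image p
      ; resp      = λ b≈c (a , a∈p , pa≈b) → a , a∈p , B.trans pa≈b b≈c
      ; isGuarded = Image-isGuarded p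
      }
    ; φ = λ p → record
      { func = record
        { to   = λ (a , a∈p) → at p a∈p , (a , a∈p , B.refl)
        ; cong = at-cong ≋-refl
        }
      ; preserves = λ R {t} → at-preserves p R t
      }
    ; agrees = λ p X _ _ → at-∷ʳ A.refl
    ; Y-cong = λ p≋q → Image-cong p≋q , Image-cong (≋-sym p≋q)
    ; φ-cong = λ p≋q _ _ → at-cong p≋q A.refl
    }
    where
    open FromHomomorphism g A B h

    Image-isGuarded : ∀ p → IsGuarded B g (Image p)
    Image-isGuarded p with isGuarded (last g A p)
    ... | n , γ , t , ⊨γ , p⊆t with supportImage-isGuard A B g h p γ t ⊨γ
    ...   | δ , ⊨δ = n , δ , supportImage A B g h p γ t ⊨γ , ⊨δ ,
      -- The support is one further move after `p`, so values on the last set of `p` do not change.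
      λ (a , a∈p , pa≈b) → let i , ti≈a = p⊆t a∈p in i , B.trans (at-∷ʳ ti≈a) pa≈b

  module _ (S : WinningStrategy g A B) where
    open WinningStrategy S

    value-cong : ∀ p {a b} (a∈p : a ∈ lastSet p) (b∈p : b ∈ lastSet p) →
                 a A.≈ b → value p a∈p B.≈ value p b∈p
    value-cong p _ _ = Homomorphism.cong (φ p)

    -- Induction along the path: `OnPath` keeps `a` in every intermediate last set, so `agrees`
    -- applies at each move.
    value-path : ∀ {m p a} → m ⊑ᴾ p → OnPath g A a m p →
                 (a∈m : a ∈ lastSet m) (a∈p : a ∈ lastSet p) → value m a∈m B.≈ value p a∈p
    value-path (equal m≋p) path a∈m a∈p = φ-cong m≋p a∈m a∈p
    value-path (later {q = p} {X} m⊑p) path a∈m a∈X =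
      B.trans (value-path m⊑p (λ u m⊑u u⊑p → path u m⊑u (later u⊑p)) a∈m a∈p)
              (B.sym (agrees p X a∈p a∈X))
      where a∈p = path p m⊑p (later ⊑-refl)

    focusValue : FocussedPlay g A → Carrier B
    focusValue ⟨ p , (_ , a∈p) ⟩ = value p a∈p

    -- Both values are compared with the value of `a` at the meet.
    focusValue-∼ : ∀ {x y} → _∼_ g A x y → focusValue x B.≈ focusValue y
    focusValue-∼ {⟨ p , (a , a∈p) ⟩} {⟨ q , (b , b∈q) ⟩} x∼y =
      B.trans (B.sym (value-path prefixˡ pathˡ a∈m a∈p))
      (B.trans (value-path prefixʳ pathʳ a∈m a∈q)
               (value-cong q a∈q b∈q samePoint))
      where
      open _∼_ x∼y
      open IsGreatestCommonPrefix isMeet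
      a∈m = pathˡ meet ⊑-refl prefixˡ
      -- `pathʳ` follows `a` rather than `b`, so `a` is carried to the end of `q` and exchanged for
      -- `b` only there.
      a∈q = resp (last g A q) (A.sym samePoint) b∈q

    focusValue-cong : ∀ {x y} → Structure._≈_ (𝔾 g A) x y → focusValue x B.≈ focusValue y
    focusValue-cong = EqClosure.gfold B.isEquivalence focusValue focusValue-∼

    fromStrategy : Homomorphism (𝔾 g A) B
    fromStrategy = record
      { func      = record { to = focusValue ; cong = focusValue-cong }
      -- A related tuple in `𝔾` has representatives over one common play `p`, so the single partial
      -- homomorphism `φ p` suffices.
      ; preserves = λ R (p , as , Ras , xs≈) →
          rel-resp B R (λ i → B.sym (focusValue-cong (xs≈ i))) (Homomorphism.preserves (φ p) R {as} Ras)
      }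

theorem3p7 : {s ℓ : Level} {σ : Vocabulary s} (g : Guarding) (A B : Structure σ ℓ) →
    Bijection (homomorphisms (𝔾 g A) B) (winningStrategies g A B)
    × (A ≼[ g ] B ⇔ Homomorphism (𝔾 g A) B)
theorem3p7 g A B = record
  { to        = toStrategy g A B
  ; cong      = λ f≈h p a∈p → f≈h ⟨ p , (_ , a∈p) ⟩
  -- Both equalities are pointwise over focussed plays, so injectivity is reindexing. For
  -- surjectivity, the strategy built from `h` has value `h` at each focussed play, and
  -- `fromStrategy` reads off the value of `S` there.
  ; bijective = (λ S≈T x → S≈T (FocussedPlay.play x) (proj₂ (FocussedPlay.focus x)))
              , λ S → fromStrategy g A B S , λ h≈ p a∈p → h≈ ⟨ p , (_ , a∈p) ⟩
  } , mk⇔ (fromStrategy g A B) (toStrategy g A B)
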